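{- Let $m$ be an even (nonnegative) integer and $l$ a positive integer. For an $m \times m$ skew-symmetric matrix $A$, an $l \times l$ skew-symmetric matrix $B$, and an $m \times l$ matrix $S$, we have $$ \sum_K \operatorname{Pf} B(K)\, \operatorname{Pf} \begin{pmatrix} A & S([m];K) \\ - {}^t S([m];K) & O \end{pmatrix} = \operatorname{Pf} \left( A - S B\, {}^t S \right), $$ where $K$ runs over all even-element subsets of $[l]$ (including the empty set).
   Context: All matrices have entries in a fixed commutative ring; skew-symmetric means ${}^tX=-X$ with zero diagonal, where ${}^tX$ is the transpose. For a skew-symmetric matrix $X=(x_{ij})_{1\le i,j\le 2r}$ of even order, the Pfaffian is $$\operatorname{Pf}(X)=\sum_{\sigma\in F_{2r}}\operatorname{sgn}(\sigma)\prod_{i=1}^r x_{\sigma(2i-1),\sigma(2i)},$$ where $F_{2r}$ is the set of permutations $\sigma\in S_{2r}$ with $\sigma(1)<\sigma(3)<\dots<\sigma(2r-1)$ and $\sigma(2i-1)<\sigma(2i)$ for $1\le i\le r$. The Pfaffian of the empty ($0\times 0$) matrix is $1$. We write $[n]=\{1,2,\dots,n\}$. For an $M\times N$ matrix $X$ and subsets $I\subset[M]$, $J\subset[N]$, $X(I;J)$ denotes the submatrix of $X$ with rows indexed by $I$ and columns indexed by $J$ (in increasing order); for a skew-symmetric $X$ we write $X(I)=X(I;I)$. $O$ denotes a zero matrix of the appropriate size. -}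

module Defs where

open import Algebra.Bundles using (CommutativeRing)
open import Data.Bool.Base using (true; false)
open import Data.Fin.Base using (Fin; zero; suc; combine; _<_)
open import Data.Fin.Patterns using (0F; 1F)
open import Data.Fin.Permutation using (Permutation′; _⟨$⟩ʳ_; id; insert)
open import Data.Fin.Properties using (_<?_; all?)
open import Data.Fin.Subset using (Subset; ∣_∣; inside; outside)
open import Data.List.Base
  using (List; []; _∷_; _++_; map; concatMap; mapMaybe; filter; foldr; length;
         allFin; cartesianProduct)
import Data.Maybe.Base as Maybe
open import Data.Nat.Base using (ℕ; zero; suc; _+_; _*_)
open import Data.Nat.Divisibility using (_∣_; divides; _∣?_)
open import Data.Product.Base using (Σ-syntax; _×_; _,_; proj₁; proj₂)
open import Data.Vec.Base using ([]; _∷_)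
open import Data.Vec.Functional as Vector using (Vector)
open import Relation.Binary.PropositionalEquality.Core using (refl)
open import Relation.Nullary using (Dec; dec⇒maybe)
open import Relation.Nullary.Decidable using (_×-dec_; _→-dec_)

private
  variable
    m n p q r : ℕ

-- Every permutation of Fin (suc n) arises exactly once, from the image i of
-- zero and the permutation of Fin n left after deleting zero and i.
permutations : ∀ n → List (Permutation′ n)
permutations zero    = id ∷ []
permutations (suc n) =
  concatMap (λ i → map (insert zero i) (permutations n)) (allFin (suc n))

inversions : Permutation′ n → ℕ
inversions {n} σ =
  length (filter (λ ij → (proj₁ ij <? proj₂ ij)
                         ×-dec (σ ⟨$⟩ʳ proj₂ ij <? σ ⟨$⟩ʳ proj₁ ij))
                 (cartesianProduct (allFin n) (allFin n)))

-- For i counted from 0, `combine i 0F` and `combine i 1F` are the positions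
-- 2i and 2i+1 of Fin (r * 2), which are the positions 2i-1 and 2i when
-- everything is counted from 1.
fst snd : Fin r → Fin (r * 2)
fst i = combine i 0F
snd i = combine i 1F

-- The set F₂ᵣ of permutations indexing the terms of the Pfaffian.
InF : ∀ r → Permutation′ (r * 2) → Set
InF r σ = (∀ i j → i < j → σ ⟨$⟩ʳ fst {r} i < σ ⟨$⟩ʳ fst {r} j)
        × (∀ i → σ ⟨$⟩ʳ fst {r} i < σ ⟨$⟩ʳ snd {r} i)

inF? : ∀ r (σ : Permutation′ (r * 2)) → Dec (InF r σ)
inF? r σ =
  all? (λ i → all? λ j → (i <? j) →-dec (σ ⟨$⟩ʳ fst {r} i <? σ ⟨$⟩ʳ fst {r} j))
  ×-dec all? (λ i → σ ⟨$⟩ʳ fst {r} i <? σ ⟨$⟩ʳ snd {r} i)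

subsets : ∀ n → List (Subset n)
subsets zero    = [] ∷ []
subsets (suc n) = map (outside ∷_) (subsets n) ++ map (inside ∷_) (subsets n)

EvenSubset : ℕ → Set
EvenSubset n = Σ[ K ∈ Subset n ] 2 ∣ ∣ K ∣

evenSubsets : ∀ n → List (EvenSubset n)
evenSubsets n =
  mapMaybe (λ K → Maybe.map (K ,_) (dec⇒maybe (2 ∣? ∣ K ∣))) (subsets n)

-- The elements of a subset, in increasing order.
element : (K : Subset n) → Fin ∣ K ∣ → Fin n
element (true  ∷ K) zero    = zero
element (true  ∷ K) (suc a) = suc (element K a)
element (false ∷ K) a       = suc (element K a)

module Matrices {c ℓ} (R : CommutativeRing c ℓ) where

  private
    module R = CommutativeRing R
  open R using (Carrier; _≈_; 0#; 1#)
  open import Algebra.Properties.Semiring.Exp R.semiring using (_^_)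
  open import Algebra.Properties.CommutativeMonoid.Sum R.+-commutativeMonoid
    using (sum)
  open import Algebra.Properties.CommutativeMonoid.Sum R.*-commutativeMonoid
    using () renaming (sum to product)

  Matrix : ℕ → ℕ → Set c
  Matrix m n = Vector (Vector Carrier n) m

  sumOver : ∀ {a} {A : Set a} → List A → (A → Carrier) → Carrier
  sumOver xs f = foldr (λ x s → f x R.+ s) 0# xs

  infix  8 _ᵀ
  infix  8 -ᴹ_
  infixl 7 _*ᴹ_
  infixl 6 _-ᴹ_

  _ᵀ : Matrix m n → Matrix n m
  X ᵀ = Vector.transpose X

  -ᴹ_ : Matrix m n → Matrix m n
  (-ᴹ X) i j = R.- X i j

  _-ᴹ_ : Matrix m n → Matrix m n → Matrix m n
  (X -ᴹ Y) i j = X i j R.- Y i j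

  _*ᴹ_ : Matrix m n → Matrix n p → Matrix m p
  (X *ᴹ Y) i k = sum (λ j → X i j R.* Y j k)

  O : Matrix m n
  O i j = 0#

  block : Matrix m p → Matrix m q → Matrix n p → Matrix n q →
          Matrix (m + n) (p + q)
  block X Y Z W =
    (λ i → X i Vector.++ Y i) Vector.++ (λ i → Z i Vector.++ W i)

  -- X(I;I).
  principal : Matrix n n → (I : Subset n) → Matrix ∣ I ∣ ∣ I ∣
  principal X I a b = X (element I a) (element I b)

  -- X([m];J).  The whole row set is kept as Fin m, since ∣ ⊤ ∣ is only
  -- propositionally equal to m.
  columns : Matrix m n → (J : Subset n) → Matrix m ∣ J ∣
  columns X J i b = X i (element J b)

  SkewSymmetric : Matrix n n → Set ℓ
  SkewSymmetric X = (∀ i j → (X ᵀ) i j ≈ (-ᴹ X) i j) × (∀ i → X i i ≈ 0#)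

  sgn : Permutation′ n → Carrier
  sgn σ = (R.- 1#) ^ inversions σ

  -- The defining formula makes sense for any square matrix of even order, so
  -- skew-symmetry is not demanded here.
  Pf : 2 ∣ n → Matrix n n → Carrier
  Pf (divides r refl) X =
    sumOver (filter (inF? r) (permutations (r * 2))) λ σ →
      sgn σ R.* product (λ i → X (σ ⟨$⟩ʳ fst {r} i) (σ ⟨$⟩ʳ snd {r} i))

{-# OPTIONS --safe #-}
-- Laplace expansion along the first row makes the Pfaffian of a form X a function pf X of words,
-- pf X (x ∷ w) = Σⱼ (-1)^j X x wⱼ pf X (w without wⱼ), alternating when X is skew.  Regard both
-- factors Pf B(K) and Pf (A S; -ᵗS O) as alternating functions of the word K, paired by summing over
-- all K (odd K contribute 0).  Under this pairing, expansion along a covector v is adjoint to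
-- contraction f ↦ Σₖ vₖ f (k ∷ _).  Expanding the bordered Pfaffian along the row a gives a term
-- with A a and a term with S a.  Moving S a across the pairing contracts pf B, which is an expansion
-- along (S B) a; moving that back contracts the bordered Pfaffian, which is an expansion along -ᵗS
-- since the corner block is O.  Hence the left-hand side obeys the recursion of pf (A - S B ᵗS).
module Submission where

open import Defs
open import Algebra.Bundles using (CommutativeRing)
open import Data.Bool.Base using (true; false; if_then_else_)
open import Data.Fin.Base using (Fin; zero; suc; toℕ; punchIn; _<_; splitAt)
open import Data.Fin.Patterns using (0F; 1F)
open import Data.Fin.Permutation using (Permutation′; _⟨$⟩ʳ_; _⟨$⟩ˡ_; insert; inverseʳ)
open import Data.Fin.Properties using (_<?_; punchIn-mono-≤; punchIn-cancel-≤; combine-surjective)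
open import Data.Fin.Subset using (Subset; ∣_∣; inside; outside)
open import Data.List.Base
  using (List; []; _∷_; _++_; map; length; tabulate; allFin; filter; concatMap; mapMaybe; cartesianProduct)
open import Data.List.Properties
  using (map-++; length-map; filter-++; length-++; length-tabulate; map-tabulate; tabulate-cong)
import Data.Maybe.Base as Maybe
open import Data.Nat.Base using (ℕ; zero; suc; NonZero; s≤s; z≤n; s<s⁻¹)
  renaming (_<_ to _<ℕ_; _+_ to _+ℕ_; _*_ to _*ℕ_)
open import Data.Nat.Divisibility using (_∣_; divides; _∣?_; _∣0; ∣-refl; ∣m∣n⇒∣m+n)
import Data.Nat.Properties as ℕ
open import Data.Product.Base using (_×_; _,_; proj₂; uncurry)
open import Data.Sum.Base using (_⊎_; inj₁; inj₂; [_,_]′)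
open import Data.Sum.Properties using ([,]-map)
open import Data.Vec.Base using (_∷_)
open import Function.Base using (_∘_; id)
open import Relation.Binary.PropositionalEquality as ≡ using (_≡_)
open import Relation.Nullary using (Dec; dec⇒maybe; yes; no; does; ¬_; contradiction)
open import Relation.Nullary.Decidable using (_×-dec_)
open import Relation.Unary using (Decidable)

-- Inversion numbers of permutations built by insertion.

module Inversions where

  open import Algebra.Properties.CommutativeMonoid.Sum ℕ.+-0-commutativeMonoid
    using (sum; sum-cong-≗; sum-permute; sum-replicate-zero)
  open ≡.≡-Reasoning

  count : ∀ {p} {P : Set p} → Dec P → ℕ
  count d = if does d then 1 else 0

  count-cong : ∀ {p q} {P : Set p} {Q : Set q} (P? : Dec P) (Q? : Dec Q) →
    (P → Q) → (Q → P) → count P? ≡ count Q?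
  count-cong (yes _) (yes _) f g = ≡.refl
  count-cong (yes p) (no ¬q) f g = contradiction (f p) ¬q
  count-cong (no ¬p) (yes q) f g = contradiction (g q) ¬p
  count-cong (no _)  (no _)  f g = ≡.refl

  length-filter-tabulate : ∀ {a p} {A : Set a} {P : A → Set p} (P? : Decidable P) {n} (f : Fin n → A) →
    length (filter P? (tabulate f)) ≡ sum (λ i → count (P? (f i)))
  length-filter-tabulate P? {zero}  f = ≡.refl
  length-filter-tabulate P? {suc n} f with does (P? (f zero))
  ... | true  = ≡.cong suc (length-filter-tabulate P? (f ∘ suc))
  ... | false = length-filter-tabulate P? (f ∘ suc)

  length-filter-map : ∀ {a b p} {A : Set a} {B : Set b} {P : B → Set p} (P? : Decidable P) (f : A → B) xs →
    length (filter P? (map f xs)) ≡ length (filter (P? ∘ f) xs)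
  length-filter-map P? f []       = ≡.refl
  length-filter-map P? f (x ∷ xs) with does (P? (f x))
  ... | true  = ≡.cong suc (length-filter-map P? f xs)
  ... | false = length-filter-map P? f xs

  length-filter-cartesianProduct : ∀ {a b p} {A : Set a} {B : Set b} {P : A × B → Set p} (P? : Decidable P)
    {m n} (f : Fin m → A) (g : Fin n → B) →
    length (filter P? (cartesianProduct (tabulate f) (tabulate g)))
    ≡ sum (λ i → sum λ j → count (P? (f i , g j)))
  length-filter-cartesianProduct P? {zero}  f g = ≡.refl
  length-filter-cartesianProduct P? {suc m} f g = begin
    length (filter P? (map (f zero ,_) ys ++ zs))
      ≡⟨ ≡.cong length (filter-++ P? (map (f zero ,_) ys) zs) ⟩
    length (filter P? (map (f zero ,_) ys) ++ filter P? zs)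
      ≡⟨ length-++ (filter P? (map (f zero ,_) ys)) ⟩
    length (filter P? (map (f zero ,_) ys)) +ℕ length (filter P? zs)
      ≡⟨ ≡.cong₂ _+ℕ_ (≡.trans (length-filter-map P? (f zero ,_) ys) (length-filter-tabulate (P? ∘ (f zero ,_)) g))
           (length-filter-cartesianProduct P? (f ∘ suc) g) ⟩
    sum (λ i → sum λ j → count (P? (f i , g j))) ∎
    where
    ys = tabulate g
    zs = cartesianProduct (tabulate (f ∘ suc)) ys

  inverted? : ∀ {n} (σ : Permutation′ n) (i j : Fin n) → Dec ((i < j) × (σ ⟨$⟩ʳ j < σ ⟨$⟩ʳ i))
  inverted? σ i j = (i <? j) ×-dec (σ ⟨$⟩ʳ j <? σ ⟨$⟩ʳ i)

  inversions-sum : ∀ {n} (σ : Permutation′ n) →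
    inversions σ ≡ sum (λ i → sum λ j → count (inverted? σ i j))
  inversions-sum σ = length-filter-cartesianProduct (uncurry (inverted? σ)) id id

  punchIn-cancel-< : ∀ {n} i {j k : Fin n} → punchIn i j < punchIn i k → j < k
  punchIn-cancel-< i {j} {k} p = ℕ.≰⇒> λ k≤j → ℕ.<⇒≱ p (punchIn-mono-≤ i k j k≤j)

  punchIn-mono-< : ∀ {n} i {j k : Fin n} → j < k → punchIn i j < punchIn i k
  punchIn-mono-< i {j} {k} p = ℕ.≰⇒> λ k≤j → ℕ.<⇒≱ p (punchIn-cancel-≤ i k j k≤j)

  -- `punchIn i` enumerates every index other than `i`, and exactly `toℕ i` of those lie below `i`.
  count-below : ∀ {n} (i : Fin (suc n)) → sum (λ j → count (punchIn i j <? i)) ≡ toℕ i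
  count-below {n}     zero    = sum-replicate-zero n
  count-below {suc n} (suc i) = ≡.cong suc (≡.trans
    (sum-cong-≗ λ j → count-cong (punchIn (suc i) (suc j) <? suc i) (punchIn i j <? i) s<s⁻¹ s≤s)
    (count-below i))

  -- Position zero carries the value `i` and is inverted with exactly the positions of smaller
  -- value. Among the other positions nothing changes, because `punchIn i` is strictly increasing.
  inversions-insert : ∀ {n} i (σ : Permutation′ n) →
    inversions (insert zero i σ) ≡ toℕ i +ℕ inversions σ
  inversions-insert {n} i σ = begin
    inversions σ⁺
      ≡⟨ inversions-sum σ⁺ ⟩
    -- Pairs with second index zero have vanished by computation: nothing lies below zero.
    sum (λ j → count (inverted? σ⁺ zero (suc j)))
      +ℕ sum (λ j → sum λ k → count (inverted? σ⁺ (suc j) (suc k)))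
      ≡⟨ ≡.cong₂ _+ℕ_ (sum-cong-≗ λ j → count-cong (inverted? σ⁺ zero (suc j)) (punchIn i (σ ⟨$⟩ʳ j) <? i)
                          proj₂ (s≤s z≤n ,_))
           (sum-cong-≗ λ j → sum-cong-≗ λ k → count-cong (inverted? σ⁺ (suc j) (suc k)) (inverted? σ j k)
              (λ (p , q) → s<s⁻¹ p , punchIn-cancel-< i q) (λ (p , q) → s≤s p , punchIn-mono-< i q)) ⟩
    sum (λ j → count (punchIn i (σ ⟨$⟩ʳ j) <? i)) +ℕ sum (λ j → sum λ k → count (inverted? σ j k))
      -- Only the set of values of `σ` matters in the first sum, so `σ` is reindexed away.
      ≡⟨ ≡.cong₂ _+ℕ_ (≡.sym (sum-permute (λ j → count (punchIn i j <? i)) σ)) (≡.sym (inversions-sum σ)) ⟩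
    sum (λ j → count (punchIn i j <? i)) +ℕ inversions σ
      ≡⟨ ≡.cong (_+ℕ inversions σ) (count-below i) ⟩
    toℕ i +ℕ inversions σ ∎
    where σ⁺ = insert zero i σ

open Inversions using (inversions-insert; punchIn-cancel-<; punchIn-mono-<)

-- The index set F under removal of its first pair.

-- The value zero must sit somewhere. At a later `fst` position it would exceed the value at the
-- first one, and at a `snd` position it would exceed its partner. Only position zero is left, and
-- its value is `i`.
InF-insert⇒≡0 : ∀ r i (σ : Permutation′ (suc (r *ℕ 2))) → InF (suc r) (insert zero i σ) → i ≡ zero
InF-insert⇒≡0 r i σ (fst< , fst<snd) = from-preimage (combine-surjective {suc r} {2} (σ⁺ ⟨$⟩ˡ zero))
  where
  σ⁺ = insert zero i σ
  from-preimage : (_ : _) → i ≡ zero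
  from-preimage (zero  , 0F , eq) = ≡.trans (≡.cong (σ⁺ ⟨$⟩ʳ_) eq) (inverseʳ σ⁺)
  from-preimage (suc k , 0F , eq) = contradiction
    (≡.subst (i <_) (≡.trans (≡.cong (σ⁺ ⟨$⟩ʳ_) eq) (inverseʳ σ⁺)) (fst< zero (suc k) (s≤s z≤n))) λ ()
  from-preimage (k     , 1F , eq) = contradiction
    (≡.subst (σ⁺ ⟨$⟩ʳ fst k <_) (≡.trans (≡.cong (σ⁺ ⟨$⟩ʳ_) eq) (inverseʳ σ⁺)) (fst<snd k)) λ ()

module _ (r : ℕ) (j : Fin (suc (r *ℕ 2))) (σ : Permutation′ (r *ℕ 2)) where

  -- Both directions together say that a member of F for `suc r` is a partner `suc j` of zero and a
  -- member of F for `r`. The Laplace expansion rests on this.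
  InF-insert⁻ : InF (suc r) (insert zero zero (insert zero j σ)) → InF r σ
  InF-insert⁻ (fst< , fst<snd) =
    (λ a b a<b → punchIn-cancel-< j (s<s⁻¹ (fst< (suc a) (suc b) (s≤s a<b)))) ,
    (λ a → punchIn-cancel-< j (s<s⁻¹ (fst<snd (suc a))))

  -- Conditions on the first pair come for free, since position zero holds the least value; the
  -- others transfer along the increasing map `punchIn j`.
  InF-insert⁺ : InF r σ → InF (suc r) (insert zero zero (insert zero j σ))
  InF-insert⁺ (fst< , fst<snd) =
    (λ { zero    zero    ()
       ; zero    (suc b) _   → s≤s z≤n
       ; (suc a) zero    ()
       ; (suc a) (suc b) a<b → s≤s (punchIn-mono-< j (fst< a b (s<s⁻¹ a<b))) }) ,
    (λ { zero → s≤s z≤n ; (suc a) → s≤s (punchIn-mono-< j (fst<snd a)) })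

-- Signs, and expansion of functions of words along a covector.

module Words {c ℓ} (R : CommutativeRing c ℓ) where

  open CommutativeRing R hiding (zero)
  open import Algebra.Properties.Ring ring using (-1*x≈-x; -‿involutive)
  open import Algebra.Properties.Semiring.Exp semiring using (_^_)
  open import Algebra.Properties.Semiring.Sum semiring
    using (sum; sum-cong-≋; ∑-distrib-+; ∑-comm; *-distribˡ-sum; *-distribʳ-sum)
  open import Algebra.Solver.Ring.NaturalCoefficients.Default commutativeSemiring
    using (solve; _:+_; _:*_; _:=_)
  open import Relation.Binary.Reasoning.Setoid setoid

  private
    variable
      I J : Set

  -- A name for -1 lets the semiring solver treat it as a variable.
  e : Carrier
  e = - 1#

  e*e≈1 : e * e ≈ 1#
  e*e≈1 = trans (-1*x≈-x e) (-‿involutive 1#)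

  x+e*x≈0 : ∀ x → x + e * x ≈ 0#
  x+e*x≈0 x = trans (+-congˡ (-1*x≈-x x)) (-‿inverseʳ x)

  x+y≈0⇒x≈e*y : ∀ {x y} → x + y ≈ 0# → x ≈ e * y
  x+y≈0⇒x≈e*y {x} {y} p = begin
    x                ≈⟨ +-identityʳ x ⟨
    x + 0#           ≈⟨ +-congˡ (x+e*x≈0 y) ⟨
    x + (y + e * y)  ≈⟨ +-assoc x y (e * y) ⟨
    (x + y) + e * y  ≈⟨ +-congʳ p ⟩
    0# + e * y       ≈⟨ +-identityˡ _ ⟩
    e * y            ∎

  e^n*e^n≈1 : ∀ n → e ^ n * e ^ n ≈ 1#
  e^n*e^n≈1 zero    = *-identityˡ 1#
  e^n*e^n≈1 (suc n) = begin
    (e * e ^ n) * (e * e ^ n)  ≈⟨ solve 2 (λ a b → (a :* b) :* (a :* b) := (a :* a) :* (b :* b)) refl e (e ^ n) ⟩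
    (e * e) * (e ^ n * e ^ n)  ≈⟨ *-cong e*e≈1 (e^n*e^n≈1 n) ⟩
    1# * 1#                    ≈⟨ *-identityˡ 1# ⟩
    1#                         ∎

  -- The signed sum Σⱼ (-1)^j f wⱼ P (w without wⱼ). Letters passed over are put back in front
  -- inside the argument of `P`, each at the cost of a factor `e`.
  expand : (I → Carrier) → (List I → Carrier) → List I → Carrier
  expand f P []      = 0#
  expand f P (x ∷ w) = f x * P w + e * expand f (λ u → P (x ∷ u)) w

  -- Agreement is asked only on words one letter shorter, which is what an induction on the length
  -- of a word can supply.
  expand-cong : ∀ {f g : I → Carrier} {P Q : List I → Carrier} →
    (∀ x → f x ≈ g x) → ∀ w → (∀ u → suc (length u) ≡ length w → P u ≈ Q u) →
    expand f P w ≈ expand g Q w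
  expand-cong f≈g []      P≈Q = refl
  expand-cong f≈g (x ∷ w) P≈Q =
    +-cong (*-cong (f≈g x) (P≈Q w ≡.refl))
           (*-congˡ (expand-cong f≈g w λ u p → P≈Q (x ∷ u) (≡.cong suc p)))

  expand-congˡ : ∀ {f g : I → Carrier} {P : List I → Carrier} →
    (∀ x → f x ≈ g x) → ∀ w → expand f P w ≈ expand g P w
  expand-congˡ f≈g w = expand-cong f≈g w λ _ _ → refl

  expand-congʳ : ∀ {f : I → Carrier} {P Q : List I → Carrier} →
    (∀ u → P u ≈ Q u) → ∀ w → expand f P w ≈ expand f Q w
  expand-congʳ P≈Q w = expand-cong (λ _ → refl) w λ u _ → P≈Q u

  expand-0ˡ : ∀ (P : List I → Carrier) w → expand (λ _ → 0#) P w ≈ 0#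
  expand-0ˡ P []      = refl
  expand-0ˡ P (x ∷ w) = begin
    0# * P w + e * expand (λ _ → 0#) _ w  ≈⟨ +-cong (zeroˡ _) (*-congˡ (expand-0ˡ _ w)) ⟩
    0# + e * 0#                           ≈⟨ trans (+-identityˡ _) (zeroʳ e) ⟩
    0#                                    ∎

  expand-0ʳ : ∀ (f : I → Carrier) w → expand f (λ _ → 0#) w ≈ 0#
  expand-0ʳ f []      = refl
  expand-0ʳ f (x ∷ w) = begin
    f x * 0# + e * expand f (λ _ → 0#) w  ≈⟨ +-cong (zeroʳ _) (*-congˡ (expand-0ʳ f w)) ⟩
    0# + e * 0#                           ≈⟨ trans (+-identityˡ _) (zeroʳ e) ⟩
    0#                                    ∎

  expand-+ˡ : ∀ (f g : I → Carrier) P w →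
    expand (λ x → f x + g x) P w ≈ expand f P w + expand g P w
  expand-+ˡ f g P []      = sym (+-identityˡ 0#)
  expand-+ˡ f g P (x ∷ w) = trans (+-congˡ (*-congˡ (expand-+ˡ f g _ w)))
    (solve 6 (λ a b p e s t → (a :+ b) :* p :+ e :* (s :+ t) := (a :* p :+ e :* s) :+ (b :* p :+ e :* t))
      refl (f x) (g x) (P w) e _ _)

  expand-+ʳ : ∀ (f : I → Carrier) P Q w →
    expand f (λ u → P u + Q u) w ≈ expand f P w + expand f Q w
  expand-+ʳ f P Q []      = sym (+-identityˡ 0#)
  expand-+ʳ f P Q (x ∷ w) = trans (+-congˡ (*-congˡ (expand-+ʳ f _ _ w)))
    (solve 6 (λ a p q e s t → a :* (p :+ q) :+ e :* (s :+ t) := (a :* p :+ e :* s) :+ (a :* q :+ e :* t))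
      refl (f x) (P w) (Q w) e _ _)

  expand-*ˡ : ∀ a (f : I → Carrier) P w →
    expand (λ x → a * f x) P w ≈ a * expand f P w
  expand-*ˡ a f P []      = sym (zeroʳ a)
  expand-*ˡ a f P (x ∷ w) = trans (+-congˡ (*-congˡ (expand-*ˡ a f _ w)))
    (solve 5 (λ a b p e s → (a :* b) :* p :+ e :* (a :* s) := a :* (b :* p :+ e :* s))
      refl a (f x) (P w) e _)

  expand-*ʳ : ∀ a (f : I → Carrier) P w →
    expand f (λ u → a * P u) w ≈ a * expand f P w
  expand-*ʳ a f P []      = sym (zeroʳ a)
  expand-*ʳ a f P (x ∷ w) = trans (+-congˡ (*-congˡ (expand-*ʳ a f _ w)))
    (solve 5 (λ a b p e s → b :* (a :* p) :+ e :* (a :* s) := a :* (b :* p :+ e :* s))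
      refl a (f x) (P w) e _)

  expand-sumˡ : ∀ {n} (f : Fin n → I → Carrier) P w →
    expand (λ x → sum λ k → f k x) P w ≈ sum (λ k → expand (f k) P w)
  expand-sumˡ {n = zero}  f P w = expand-0ˡ P w
  expand-sumˡ {n = suc n} f P w =
    trans (expand-+ˡ _ _ P w) (+-congˡ (expand-sumˡ (f ∘ suc) P w))

  -- The deleted letter lies in `u` or in `v`; reaching `v` means passing all of `u`.
  expand-++ : ∀ (f : I → Carrier) P u v →
    expand f P (u ++ v) ≈
    expand f (λ u′ → P (u′ ++ v)) u + e ^ length u * expand f (λ v′ → P (u ++ v′)) v
  expand-++ f P []      v = sym (trans (+-identityˡ _) (*-identityˡ _))
  expand-++ f P (x ∷ u) v = trans (+-congˡ (*-congˡ (expand-++ f _ u v)))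
    (solve 5 (λ h e s t d → h :+ e :* (s :+ d :* t) := (h :+ e :* s) :+ (e :* d) :* t)
      refl _ e _ _ (e ^ length u))

  expand-map : ∀ (h : I → J) f P w →
    expand f P (map h w) ≡ expand (f ∘ h) (P ∘ map h) w
  expand-map h f P []      = ≡.refl
  expand-map h f P (x ∷ w) = ≡.cong (λ s → f (h x) * P (map h w) + e * s) (expand-map h f _ w)

  -- The letter `x` is deleted by the outer expansion, by the inner one, or by neither; in the last
  -- case it is passed twice and the signs cancel.
  expand²-∷ : ∀ (f g : I → Carrier) P x w →
    expand f (expand g P) (x ∷ w) ≈
    f x * expand g P w + (e * (g x * expand f P w)
      + expand f (expand g (λ u → P (x ∷ u))) w)
  expand²-∷ f g P x w = +-congˡ (begin
    e * expand f (λ u → g x * P u + e * expand g P′ u) w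
      ≈⟨ *-congˡ (expand-+ʳ f _ _ w) ⟩
    e * (expand f (λ u → g x * P u) w + expand f (λ u → e * expand g P′ u) w)
      ≈⟨ *-congˡ (+-cong (expand-*ʳ (g x) f P w) (expand-*ʳ e f (expand g P′) w)) ⟩
    e * (g x * expand f P w + e * expand f (expand g P′) w)
      ≈⟨ solve 3 (λ e a b → e :* (a :+ e :* b) := e :* a :+ (e :* e) :* b) refl e _ _ ⟩
    e * (g x * expand f P w) + (e * e) * expand f (expand g P′) w
      ≈⟨ +-congˡ (trans (*-congʳ e*e≈1) (*-identityˡ _)) ⟩
    e * (g x * expand f P w) + expand f (expand g P′) w ∎)
    where P′ = λ u → P (x ∷ u)

  -- Exchanging the order in which two letters are deleted changes one sign. Splitting off the first
  -- letter turns this into an induction.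
  expand-anticomm : ∀ (f g : I → Carrier) P w →
    expand f (expand g P) w + expand g (expand f P) w ≈ 0#
  expand-anticomm f g P []      = +-identityˡ 0#
  expand-anticomm f g P (x ∷ w) = begin
    expand f (expand g P) (x ∷ w) + expand g (expand f P) (x ∷ w)
      ≈⟨ +-cong (expand²-∷ f g P x w) (expand²-∷ g f P x w) ⟩
    (a + (e * b + s)) + (b + (e * a + t))
      ≈⟨ solve 5 (λ a b e s t → (a :+ (e :* b :+ s)) :+ (b :+ (e :* a :+ t))
                   := (a :+ e :* a) :+ ((b :+ e :* b) :+ (s :+ t))) refl a b e s t ⟩
    (a + e * a) + ((b + e * b) + (s + t))
      ≈⟨ +-cong (x+e*x≈0 a) (+-cong (x+e*x≈0 b) (expand-anticomm f g _ w)) ⟩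
    0# + (0# + 0#)
      ≈⟨ trans (+-identityˡ _) (+-identityˡ _) ⟩
    0# ∎
    where
    a = f x * expand g P w
    b = g x * expand f P w
    s = expand f (expand g (λ u → P (x ∷ u))) w
    t = expand g (expand f (λ u → P (x ∷ u))) w

  -- Taking `f` = `g` in `expand-anticomm` would only show that twice this is zero, and 2 may be a
  -- zero divisor.
  expand-square : ∀ (f : I → Carrier) P w → expand f (expand f P) w ≈ 0#
  expand-square f P []      = refl
  expand-square f P (x ∷ w) = begin
    expand f (expand f P) (x ∷ w)   ≈⟨ expand²-∷ f f P x w ⟩
    a + (e * a + expand f (expand f (λ u → P (x ∷ u))) w)
                                    ≈⟨ +-congˡ (+-congˡ (expand-square f _ w)) ⟩
    a + (e * a + 0#)                ≈⟨ +-congˡ (+-identityʳ _) ⟩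
    a + e * a                       ≈⟨ x+e*x≈0 a ⟩
    0#                              ∎
    where a = f x * expand f P w

  -- Alternating functions of words.

  -- `same` is a separate field because `swap` with equal letters only makes twice the value vanish.
  record Alternating {I : Set} (f : List I → Carrier) : Set ℓ where
    field
      swap : ∀ u x y w → f (u ++ x ∷ y ∷ w) + f (u ++ y ∷ x ∷ w) ≈ 0#
      same : ∀ u x w → f (u ++ x ∷ x ∷ w) ≈ 0#

  open Alternating

  Skew : {I : Set} → (I → I → Carrier) → Set ℓ
  Skew X = (∀ x y → X x y + X y x ≈ 0#) × (∀ x → X x x ≈ 0#)

  tail-alternating : ∀ {f : List I → Carrier} x → Alternating f → Alternating (λ u → f (x ∷ u))
  tail-alternating x alt = record { swap = λ u → alt .swap (x ∷ u) ; same = λ u → alt .same (x ∷ u) }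

  prefix-alternating : ∀ {f : List I → Carrier} v → Alternating f → Alternating (λ u → f (v ++ u))
  prefix-alternating []      alt = alt
  prefix-alternating (x ∷ v) alt = prefix-alternating v (tail-alternating x alt)

  map-alternating : ∀ {f : List J → Carrier} (h : I → J) →
    Alternating f → Alternating (λ u → f (map h u))
  map-alternating {f = f} h alt = record
    { swap = λ u x y w → trans
        (+-cong (reflexive (≡.cong f (map-++ h u (x ∷ y ∷ w)))) (reflexive (≡.cong f (map-++ h u (y ∷ x ∷ w)))))
        (alt .swap (map h u) (h x) (h y) (map h w))
    ; same = λ u x w → trans (reflexive (≡.cong f (map-++ h u (x ∷ x ∷ w))))
        (alt .same (map h u) (h x) (map h w))
    }

  -- When the two letters are in front, the terms deleting one of them cancel crosswise, and the
  -- terms deleting neither inherit the property from `f`. A prefix letter is passed by induction,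
  -- with `f` replaced by its tail.
  expand-alternating : ∀ (g : I → Carrier) {f} → Alternating f → Alternating (expand g f)
  expand-alternating {I = I} g alt = record { swap = swap′ alt ; same = same′ alt }
    where
    swap′ : ∀ {f} → Alternating f → ∀ u x y w →
            expand g f (u ++ x ∷ y ∷ w) + expand g f (u ++ y ∷ x ∷ w) ≈ 0#
    swap′ {f} alt [] x y w = begin
      (a + e * (b + e * s)) + (b + e * (a + e * t))
        ≈⟨ solve 5 (λ a b e s t → (a :+ e :* (b :+ e :* s)) :+ (b :+ e :* (a :+ e :* t))
                     := (a :+ e :* a) :+ ((b :+ e :* b) :+ (e :* e) :* (s :+ t))) refl a b e s t ⟩
      (a + e * a) + ((b + e * b) + (e * e) * (s + t))
        ≈⟨ +-cong (x+e*x≈0 a) (+-cong (x+e*x≈0 b) (*-congˡ s+t≈0)) ⟩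
      0# + (0# + (e * e) * 0#)
        ≈⟨ trans (+-identityˡ _) (trans (+-identityˡ _) (zeroʳ _)) ⟩
      0# ∎
      where
      a = g x * f (y ∷ w)
      b = g y * f (x ∷ w)
      s = expand g (λ u → f (x ∷ y ∷ u)) w
      t = expand g (λ u → f (y ∷ x ∷ u)) w
      s+t≈0 : s + t ≈ 0#
      s+t≈0 = begin
        s + t  ≈⟨ expand-+ʳ g _ _ w ⟨
        expand g (λ u → f (x ∷ y ∷ u) + f (y ∷ x ∷ u)) w  ≈⟨ expand-congʳ (alt .swap [] x y) w ⟩
        expand g (λ _ → 0#) w  ≈⟨ expand-0ʳ g w ⟩
        0# ∎
    swap′ {f} alt (z ∷ u) x y w = begin
      (g z * p + e * s) + (g z * q + e * t)
        ≈⟨ solve 6 (λ c p q e s t → (c :* p :+ e :* s) :+ (c :* q :+ e :* t)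
                     := c :* (p :+ q) :+ e :* (s :+ t)) refl (g z) p q e s t ⟩
      g z * (p + q) + e * (s + t)
        ≈⟨ +-cong (*-congˡ (alt .swap u x y w)) (*-congˡ (swap′ (tail-alternating z alt) u x y w)) ⟩
      g z * 0# + e * 0#
        ≈⟨ trans (+-cong (zeroʳ _) (zeroʳ _)) (+-identityˡ _) ⟩
      0# ∎
      where
      p = f (u ++ x ∷ y ∷ w)
      q = f (u ++ y ∷ x ∷ w)
      s = expand g (λ v → f (z ∷ v)) (u ++ x ∷ y ∷ w)
      t = expand g (λ v → f (z ∷ v)) (u ++ y ∷ x ∷ w)
    same′ : ∀ {f} → Alternating f → ∀ u x w → expand g f (u ++ x ∷ x ∷ w) ≈ 0#
    same′ {f} alt [] x w = begin
      a + e * (a + e * expand g (λ u → f (x ∷ x ∷ u)) w)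
        ≈⟨ +-congˡ (*-congˡ (+-congˡ (*-congˡ (trans (expand-congʳ (alt .same [] x) w) (expand-0ʳ g w))))) ⟩
      a + e * (a + e * 0#)
        ≈⟨ +-congˡ (*-congˡ (trans (+-congˡ (zeroʳ e)) (+-identityʳ a))) ⟩
      a + e * a  ≈⟨ x+e*x≈0 a ⟩
      0# ∎
      where a = g x * f (x ∷ w)
    same′ {f} alt (z ∷ u) x w = begin
      g z * f (u ++ x ∷ x ∷ w) + e * expand g (λ v → f (z ∷ v)) (u ++ x ∷ x ∷ w)
        ≈⟨ +-cong (*-congˡ (alt .same u x w)) (*-congˡ (same′ (tail-alternating z alt) u x w)) ⟩
      g z * 0# + e * 0#
        ≈⟨ trans (+-cong (zeroʳ _) (zeroʳ _)) (+-identityˡ _) ⟩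
      0# ∎

  -- Each of the `length u` adjacent swaps contributes a factor `e`.
  move-to-front : ∀ {f : List I → Carrier} → Alternating f → ∀ u x w →
    f (u ++ x ∷ w) ≈ e ^ length u * f (x ∷ u ++ w)
  move-to-front alt [] x w = sym (*-identityˡ _)
  move-to-front {f = f} alt (y ∷ u) x w = begin
    f (y ∷ u ++ x ∷ w)                       ≈⟨ move-to-front (tail-alternating y alt) u x w ⟩
    e ^ length u * f (y ∷ x ∷ u ++ w)        ≈⟨ *-congˡ (x+y≈0⇒x≈e*y (alt .swap [] y x (u ++ w))) ⟩
    e ^ length u * (e * f (x ∷ y ∷ u ++ w))
      ≈⟨ solve 3 (λ d e a → d :* (e :* a) := (e :* d) :* a) refl (e ^ length u) e _ ⟩
    (e * e ^ length u) * f (x ∷ y ∷ u ++ w)  ∎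

  -- The Pfaffian of a form as a function of words.

  -- Only meaningful on words of length less than n, where it does not depend on n.
  pfUpTo : (I → I → Carrier) → ℕ → List I → Carrier
  pfUpTo X zero    w       = 0#
  pfUpTo X (suc n) []      = 1#
  pfUpTo X (suc n) (x ∷ w) = expand (X x) (pfUpTo X n) w

  -- Words with a letter deleted are not structurally smaller, hence the bound. It exceeds the
  -- length by one because bound zero gives 0 even on the empty word.
  pf : (I → I → Carrier) → List I → Carrier
  pf X w = pfUpTo X (suc (length w)) w

  pfUpTo-stable : ∀ (X : I → I → Carrier) {m n} w → length w <ℕ m → length w <ℕ n →
    pfUpTo X m w ≈ pfUpTo X n w
  pfUpTo-stable X []      (s≤s _) (s≤s _) = refl
  pfUpTo-stable X (x ∷ w) (s≤s p) (s≤s q) = expand-cong (λ _ → refl) w λ u eq →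
    pfUpTo-stable X u (ℕ.<-trans (ℕ.≤-reflexive eq) p) (ℕ.<-trans (ℕ.≤-reflexive eq) q)

  pf-∷ : ∀ (X : I → I → Carrier) x w → pf X (x ∷ w) ≈ expand (X x) (pf X) w
  pf-∷ X x w = expand-cong (λ _ → refl) w λ u eq →
    pfUpTo-stable X u (ℕ.m≤n⇒m≤1+n (ℕ.≤-reflexive eq)) ℕ.≤-refl

  -- Expansion refers only to shorter words, so the two equations determine the function. This is
  -- how the subset sum is recognised as a Pfaffian.
  pf-unique : ∀ (X : I → I → Carrier) {F : List I → Carrier} →
    F [] ≈ 1# → (∀ x w → F (x ∷ w) ≈ expand (X x) F w) → ∀ w → F w ≈ pf X w
  pf-unique X {F} F[] F∷ w = agree w ℕ.≤-refl
    where
    agree : ∀ {n} w → length w <ℕ n → F w ≈ pfUpTo X n w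
    agree []      (s≤s _) = F[]
    agree (x ∷ w) (s≤s p) = trans (F∷ x w) (expand-cong (λ _ → refl) w λ u eq →
      agree u (ℕ.<-trans (ℕ.≤-reflexive eq) p))

  -- For two letters in front, the term pairing them with each other vanishes by skewness and the
  -- rest by anticommuting expansions. Behind a prefix, `expand-alternating` applies. The induction
  -- runs over the bound `n`.
  pf-alternating : ∀ {X : I → I → Carrier} → Skew X → Alternating (pf X)
  pf-alternating {I = I} {X} (skew , diag) = record
    { swap = swap′
    ; same = λ u x w → upTo (suc (length (u ++ x ∷ x ∷ w))) .same u x w
    }
    where
    upTo : ∀ n → Alternating (pfUpTo X n)
    swap₀ : ∀ n x y w → pfUpTo X (suc n) (x ∷ y ∷ w) + pfUpTo X (suc n) (y ∷ x ∷ w) ≈ 0#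
    swap₀ zero x y w = trans (+-cong (expand-0ʳ (X x) (y ∷ w)) (expand-0ʳ (X y) (x ∷ w))) (+-identityˡ 0#)
    swap₀ (suc n) x y w = begin
      (X x y * p + e * s) + (X y x * p + e * t)
        ≈⟨ solve 6 (λ a b p e s t → (a :* p :+ e :* s) :+ (b :* p :+ e :* t)
                     := (a :+ b) :* p :+ e :* (s :+ t)) refl (X x y) (X y x) p e s t ⟩
      (X x y + X y x) * p + e * (s + t)
        ≈⟨ +-cong (*-congʳ (skew x y)) (*-congˡ (expand-anticomm (X x) (X y) (pfUpTo X n) w)) ⟩
      0# * p + e * 0#
        ≈⟨ trans (+-cong (zeroˡ p) (zeroʳ e)) (+-identityˡ 0#) ⟩
      0# ∎
      where
      p = pfUpTo X (suc n) w
      s = expand (X x) (expand (X y) (pfUpTo X n)) w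
      t = expand (X y) (expand (X x) (pfUpTo X n)) w
    same₀ : ∀ n x w → pfUpTo X (suc n) (x ∷ x ∷ w) ≈ 0#
    same₀ zero x w = expand-0ʳ (X x) (x ∷ w)
    same₀ (suc n) x w = begin
      X x x * pfUpTo X (suc n) w + e * expand (X x) (expand (X x) (pfUpTo X n)) w
        ≈⟨ +-cong (*-congʳ (diag x)) (*-congˡ (expand-square (X x) (pfUpTo X n) w)) ⟩
      0# * pfUpTo X (suc n) w + e * 0#
        ≈⟨ trans (+-cong (zeroˡ _) (zeroʳ e)) (+-identityˡ 0#) ⟩
      0# ∎
    upTo zero    = record { swap = λ _ _ _ _ → +-identityˡ 0# ; same = λ _ _ _ → refl }
    upTo (suc n) = record
      { swap = λ { [] → swap₀ n ; (z ∷ u) → expand-alternating (X z) (upTo n) .swap u }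
      ; same = λ { [] → same₀ n ; (z ∷ u) → expand-alternating (X z) (upTo n) .same u }
      }
    swap′ : ∀ u x y w → pf X (u ++ x ∷ y ∷ w) + pf X (u ++ y ∷ x ∷ w) ≈ 0#
    swap′ u x y w = trans
      -- The two words have equal length only propositionally, so both are evaluated at a common
      -- bound larger than either length.
      (+-cong (pfUpTo-stable X v ℕ.≤-refl (s≤s (ℕ.m≤m+n _ _))) (pfUpTo-stable X v′ ℕ.≤-refl (s≤s (ℕ.m≤n+m _ _))))
      (upTo (suc (length v +ℕ length v′)) .swap u x y w)
      where
      v v′ : List I
      v  = u ++ x ∷ y ∷ w
      v′ = u ++ y ∷ x ∷ w

  -- The pairing of two functions over subsequences.

  -- The sum of f K * g K over the subsequences K of the word h 0, …, h (n - 1).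
  pair : ∀ n → (Fin n → I) → (List I → Carrier) → (List I → Carrier) → Carrier
  pair zero    h f g = f [] * g []
  pair (suc n) h f g =
    pair n (h ∘ suc) f g
    + pair n (h ∘ suc) (λ u → f (h zero ∷ u)) (λ u → g (h zero ∷ u))

  pair-cong : ∀ {n} (h : Fin n → I) {f f′ g g′} →
    (∀ u → f u ≈ f′ u) → (∀ u → g u ≈ g′ u) → pair n h f g ≈ pair n h f′ g′
  pair-cong {n = zero}  h p q = *-cong (p []) (q [])
  pair-cong {n = suc n} h p q =
    +-cong (pair-cong (h ∘ suc) p q) (pair-cong (h ∘ suc) (λ u → p (h zero ∷ u)) (λ u → q (h zero ∷ u)))

  pair-comm : ∀ {n} (h : Fin n → I) f g → pair n h f g ≈ pair n h g f
  pair-comm {n = zero}  h f g = *-comm _ _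
  pair-comm {n = suc n} h f g = +-cong (pair-comm (h ∘ suc) f g) (pair-comm (h ∘ suc) _ _)

  pair-+ʳ : ∀ {n} (h : Fin n → I) f g g′ →
    pair n h f (λ u → g u + g′ u) ≈ pair n h f g + pair n h f g′
  pair-+ʳ {n = zero}  h f g g′ = distribˡ _ _ _
  pair-+ʳ {n = suc n} h f g g′ = trans (+-cong (pair-+ʳ (h ∘ suc) f g g′) (pair-+ʳ (h ∘ suc) _ _ _))
    (solve 4 (λ a b c d → (a :+ b) :+ (c :+ d) := (a :+ c) :+ (b :+ d)) refl _ _ _ _)

  pair-*ʳ : ∀ {n} (h : Fin n → I) a f g →
    pair n h f (λ u → a * g u) ≈ a * pair n h f g
  pair-*ʳ {n = zero}  h a f g = solve 3 (λ a b c → b :* (a :* c) := a :* (b :* c)) refl a _ _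
  pair-*ʳ {n = suc n} h a f g = trans (+-cong (pair-*ʳ (h ∘ suc) a f g) (pair-*ʳ (h ∘ suc) a _ _))
    (sym (distribˡ a _ _))

  -- The coefficients of the expansion over `w` do not depend on `K`, so linearity of the pairing
  -- suffices.
  pair-expand : ∀ {n} (h : Fin n → I) f (a : J → Carrier) (P : List J → List I → Carrier) w →
    pair n h f (λ K → expand a (λ u → P u K) w) ≈ expand a (λ u → pair n h f (P u)) w
  pair-expand {n = zero}  h f a P w = sym (expand-*ʳ _ a (λ u → P u []) w)
  pair-expand {n = suc n} h f a P w =
    trans (+-cong (pair-expand (h ∘ suc) f a P w) (pair-expand (h ∘ suc) _ a _ w))
          (sym (expand-+ʳ a _ _ w))

  -- Deleting a letter k from K carries the same sign as moving k to the front of K in `f`, so each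
  -- term on the left matches one on the right. The remaining terms on the right repeat a letter and
  -- vanish.
  pair-adjoint : ∀ {n} (h : Fin n → I) {f} → Alternating f → ∀ (v : I → Carrier) g →
    pair n h f (expand v g) ≈ sum (λ k → v (h k) * pair n h (λ u → f (h k ∷ u)) g)
  pair-adjoint {n = zero}  h alt v g = zeroʳ _
  pair-adjoint {n = suc n} h {f} alt v g = begin
    pair n h′ f (expand v g)
      + pair n h′ f₀ (λ u → v (h zero) * g u + e * expand v g₀ u)
      ≈⟨ +-cong (pair-adjoint h′ alt v g) (trans (pair-+ʳ h′ f₀ _ _) (+-cong (pair-*ʳ h′ _ f₀ g)
           (trans (pair-*ʳ h′ e f₀ _) (*-congˡ (pair-adjoint h′ (tail-alternating (h zero) alt) v g₀))))) ⟩
    sum a + (v (h zero) * pair n h′ f₀ g + e * sum b)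
      ≈⟨ solve 4 (λ s t e r → s :+ (t :+ e :* r) := t :+ (s :+ e :* r)) refl (sum a) _ e (sum b) ⟩
    v (h zero) * pair n h′ f₀ g + (sum a + e * sum b)
      -- Adding the subsequences that contain `h zero` changes nothing, as `f` then sees that letter
      -- twice.
      ≈⟨ +-cong (*-congˡ (sym (trans (+-congˡ vanish) (+-identityʳ _))))
           (trans (+-congˡ (*-distribˡ-sum e b)) (sym (∑-distrib-+ a _))) ⟩
    v (h zero) * pair (suc n) h f₀ g + sum (λ k → a k + e * b k)
      -- By `exchange`, `a k` and `e * b k` are the parts without and with `h zero` of the
      -- contraction by `h′ k`.
      ≈⟨ +-congˡ (sum-cong-≋ λ k → trans
           (solve 4 (λ v p e q → v :* p :+ e :* (v :* q) := v :* (p :+ e :* q)) refl (v (h′ k)) _ e _)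
           (*-congˡ (+-congˡ (sym (exchange k))))) ⟩
    v (h zero) * pair (suc n) h f₀ g + sum (λ k → v (h′ k) * pair (suc n) h (λ u → f (h′ k ∷ u)) g) ∎
    where
    h′ = h ∘ suc
    f₀ = λ u → f (h zero ∷ u)
    g₀ = λ u → g (h zero ∷ u)
    a b : Fin n → Carrier
    a k = v (h′ k) * pair n h′ (λ u → f (h′ k ∷ u)) g
    b k = v (h′ k) * pair n h′ (λ u → f (h zero ∷ h′ k ∷ u)) g₀
    pair-*ˡ : ∀ c f′ → pair n h′ (λ u → c * f′ u) g₀ ≈ c * pair n h′ f′ g₀
    pair-*ˡ c f′ = trans (pair-comm h′ _ g₀) (trans (pair-*ʳ h′ c g₀ f′) (*-congˡ (pair-comm h′ g₀ f′)))
    exchange : ∀ k → pair n h′ (λ u → f (h′ k ∷ h zero ∷ u)) g₀ ≈ e * pair n h′ (λ u → f (h zero ∷ h′ k ∷ u)) g₀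
    exchange k = trans (pair-cong h′ (λ u → x+y≈0⇒x≈e*y (alt .swap [] (h′ k) (h zero) u)) λ _ → refl) (pair-*ˡ e _)
    vanish : pair n h′ (λ u → f (h zero ∷ h zero ∷ u)) g₀ ≈ 0#
    vanish = begin
      pair n h′ (λ u → f (h zero ∷ h zero ∷ u)) g₀
        -- Zero is written as a product so that a factor zero can be pulled out of the pairing.
        ≈⟨ pair-cong h′ (λ u → trans (alt .same [] (h zero) u) (sym (zeroˡ 0#))) (λ _ → refl) ⟩
      pair n h′ (λ u → 0# * 0#) g₀      ≈⟨ pair-*ˡ 0# (λ _ → 0#) ⟩
      0# * pair n h′ (λ _ → 0#) g₀      ≈⟨ zeroˡ _ ⟩
      0#                                ∎

  pair-0ʳ : ∀ {n} (h : Fin n → I) f {g} → (∀ u → g u ≈ 0#) → pair n h f g ≈ 0#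
  pair-0ʳ {n = zero}  h f g≈0 = trans (*-congˡ (g≈0 [])) (zeroʳ _)
  pair-0ʳ {n = suc n} h f g≈0 =
    trans (+-cong (pair-0ʳ (h ∘ suc) f g≈0) (pair-0ʳ (h ∘ suc) _ (λ u → g≈0 (h zero ∷ u)))) (+-identityˡ 0#)

  pair-δʳ : ∀ {n} (h : Fin n → I) f {g} → g [] ≈ 1# → (∀ x u → g (x ∷ u) ≈ 0#) →
    pair n h f g ≈ f []
  pair-δʳ {n = zero}  h f g[] g∷ = trans (*-congˡ g[]) (*-identityʳ _)
  pair-δʳ {n = suc n} h f g[] g∷ =
    trans (+-cong (pair-δʳ (h ∘ suc) f g[] g∷) (pair-0ʳ (h ∘ suc) _ (g∷ (h zero)))) (+-identityʳ _)

  -- The subset sum satisfies the recursion of a Pfaffian.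

  module _ {I : Set} {l : ℕ} (A : I → I → Carrier) (B : Fin l → Fin l → Carrier)
           (S : I → Fin l → Carrier) where

    -- The matrix ( A S ; -ᵗS O ), indexed by a disjoint union.
    bordered : I ⊎ Fin l → I ⊎ Fin l → Carrier
    bordered (inj₁ a) (inj₁ b) = A a b
    bordered (inj₁ a) (inj₂ k) = S a k
    bordered (inj₂ k) (inj₁ a) = - S a k
    bordered (inj₂ j) (inj₂ k) = 0#

    bordered-skew : Skew A → Skew bordered
    bordered-skew (skew , diag) =
      (λ { (inj₁ a) (inj₁ b) → skew a b
         ; (inj₁ a) (inj₂ k) → -‿inverseʳ (S a k)
         ; (inj₂ k) (inj₁ a) → -‿inverseˡ (S a k)
         ; (inj₂ _) (inj₂ _) → +-identityˡ 0# }) ,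
      (λ { (inj₁ a) → diag a ; (inj₂ _) → refl })

    SB : I → Fin l → Carrier
    SB a k = sum λ j → S a j * B j k

    -- The entries of A - S B ᵗS, bracketed as (S B) ᵗS to agree by computation with the matrix in
    -- the theorem.
    congruent : I → I → Carrier
    congruent a b = A a b - sum λ k → SB a k * S b k

    pfBordered : List I → List (Fin l) → Carrier
    pfBordered w K = pf bordered (map inj₁ w ++ map inj₂ K)

    -- First-row expansion split at the border. It is used with `x` a row of `A` and with `x` a
    -- border row.
    pfBordered-∷ : ∀ x w K → pf bordered (x ∷ map inj₁ w ++ map inj₂ K) ≈
      expand (λ a → bordered x (inj₁ a)) (λ u → pfBordered u K) w
      + e ^ length w * expand (λ k → bordered x (inj₂ k)) (pfBordered w) K
    pfBordered-∷ x w K = begin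
      pf bordered (x ∷ w′ ++ K′)
        ≈⟨ pf-∷ bordered x (w′ ++ K′) ⟩
      expand (bordered x) (pf bordered) (w′ ++ K′)
        ≈⟨ expand-++ (bordered x) _ w′ K′ ⟩
      expand (bordered x) (λ u → pf bordered (u ++ K′)) w′
        + e ^ length w′ * expand (bordered x) (λ u → pf bordered (w′ ++ u)) K′
        ≡⟨ ≡.cong₂ _+_ (expand-map inj₁ (bordered x) _ w)
             (≡.cong₂ (λ n y → e ^ n * y) (length-map inj₁ w) (expand-map inj₂ (bordered x) _ K)) ⟩
      expand (λ a → bordered x (inj₁ a)) (λ u → pfBordered u K) w
        + e ^ length w * expand (λ k → bordered x (inj₂ k)) (pfBordered w) K ∎
      where
      w′ = map inj₁ w
      K′ = map inj₂ K

    -- The left-hand side for an arbitrary word of rows, so that a recursion on the word can be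
    -- stated.
    subsetSum : List I → Carrier
    subsetSum w = pair l id (pf B) (pfBordered w)

    module _ (skewA : Skew A) (skewB : Skew B) where

      pfBordered-alternating : ∀ w → Alternating (pfBordered w)
      pfBordered-alternating w =
        map-alternating inj₂ (prefix-alternating (map inj₁ w) (pf-alternating (bordered-skew skewA)))

      -- Once moved past `w`, the border row of `k` meets `w` through -ᵗS, which gives the inner
      -- `e`, and meets `K` only in the zero corner.
      pfBordered-contract : ∀ w k K → pfBordered w (k ∷ K) ≈
        e ^ length w * (e * expand (λ a → S a k) (λ u → pfBordered u K) w)
      pfBordered-contract w k K = begin
        pf bordered (map inj₁ w ++ inj₂ k ∷ map inj₂ K)
          ≈⟨ move-to-front (pf-alternating (bordered-skew skewA)) (map inj₁ w) (inj₂ k) (map inj₂ K) ⟩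
        e ^ length (map inj₁ w) * pf bordered (inj₂ k ∷ map inj₁ w ++ map inj₂ K)
          ≈⟨ *-cong (reflexive (≡.cong (e ^_) (length-map inj₁ w))) (pfBordered-∷ (inj₂ k) w K) ⟩
        e ^ length w * (expand (λ a → - S a k) (λ u → pfBordered u K) w
                        + e ^ length w * expand (λ _ → 0#) (pfBordered w) K)
          ≈⟨ *-congˡ (+-cong (trans (expand-congˡ (λ a → sym (-1*x≈-x (S a k))) w) (expand-*ˡ e _ _ w))
                             (trans (*-congˡ (expand-0ˡ _ K)) (zeroʳ _))) ⟩
        e ^ length w * (e * expand (λ a → S a k) (λ u → pfBordered u K) w + 0#)
          ≈⟨ *-congˡ (+-identityʳ _) ⟩
        e ^ length w * (e * expand (λ a → S a k) (λ u → pfBordered u K) w) ∎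

      -- Contracting `pf B` by `j` is expansion along the row `B j`, whose adjoint is contraction of
      -- the bordered Pfaffian.
      pair-pfB : ∀ j w → pair l id (λ u → pf B (j ∷ u)) (pfBordered w) ≈
        sum λ k → B j k * (e ^ length w * (e * expand (λ a → S a k) subsetSum w))
      pair-pfB j w = begin
        pair l id (λ u → pf B (j ∷ u)) (pfBordered w)
          ≈⟨ pair-cong id (pf-∷ B j) (λ _ → refl) ⟩
        pair l id (expand (B j) (pf B)) (pfBordered w)
          -- The sides are exchanged so that `pfBordered w` takes the alternating role in
          -- `pair-adjoint`.
          ≈⟨ pair-comm {n = l} id _ _ ⟩
        pair l id (pfBordered w) (expand (B j) (pf B))
          ≈⟨ pair-adjoint id (pfBordered-alternating w) (B j) (pf B) ⟩
        sum (λ k → B j k * pair l id (λ u → pfBordered w (k ∷ u)) (pf B))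
          ≈⟨ sum-cong-≋ (λ k → *-congˡ {B j k} (trans (pair-comm {n = l} id _ _)
               (trans (pair-cong {n = l} id (λ _ → refl) (pfBordered-contract w k))
               (trans (pair-*ʳ {n = l} id _ _ _) (*-congˡ (trans (pair-*ʳ {n = l} id e _ _)
                 (*-congˡ (pair-expand {n = l} id _ _ pfBordered w)))))))) ⟩
        sum (λ k → B j k * (e ^ length w * (e * expand (λ a → S a k) subsetSum w))) ∎

      -- One factor `q` comes from passing `w` to reach the border columns, the other from moving a
      -- border letter in front of `w`, and they cancel. The surviving `e` is the minus sign in A -
      -- S B ᵗS.
      subsetSum-∷ : ∀ a w → subsetSum (a ∷ w) ≈ expand (congruent a) subsetSum w
      subsetSum-∷ a w = begin
        pair l id (pf B) (pfBordered (a ∷ w))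
          ≈⟨ pair-cong id (λ _ → refl) (pfBordered-∷ (inj₁ a) w) ⟩
        pair l id (pf B) (λ K → expand (A a) (λ u → pfBordered u K) w + q * expand (S a) (pfBordered w) K)
          ≈⟨ pair-+ʳ id (pf B) _ _ ⟩
        pair l id (pf B) (λ K → expand (A a) (λ u → pfBordered u K) w)
          + pair l id (pf B) (λ K → q * expand (S a) (pfBordered w) K)
          ≈⟨ +-cong (pair-expand id (pf B) (A a) pfBordered w) (pair-*ʳ id q (pf B) _) ⟩
        expand (A a) subsetSum w + q * pair l id (pf B) (expand (S a) (pfBordered w))
          ≈⟨ +-congˡ (*-congˡ (trans (pair-adjoint id (pf-alternating skewB) (S a) (pfBordered w))
               (sum-cong-≋ λ j → *-congˡ (pair-pfB j w)))) ⟩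
        expand (A a) subsetSum w + q * sum (λ j → S a j * sum λ k → B j k * (q * (e * E k)))
          ≈⟨ +-congˡ (trans (double-sum (S a) B E) (*-congˡ (trans
               (sum-cong-≋ λ k → sym (expand-*ˡ (SB a k) (λ b → S b k) subsetSum w))
               (sym (expand-sumˡ (λ k b → SB a k * S b k) subsetSum w))))) ⟩
        expand (A a) subsetSum w + e * expand (λ b → sum λ k → SB a k * S b k) subsetSum w
          ≈⟨ +-congˡ (trans (sym (expand-*ˡ e _ subsetSum w)) (expand-congˡ (λ b → -1*x≈-x _) w)) ⟩
        expand (A a) subsetSum w + expand (λ b → - sum λ k → SB a k * S b k) subsetSum w
          ≈⟨ expand-+ˡ (A a) _ subsetSum w ⟨
        expand (congruent a) subsetSum w ∎
        where
        q = e ^ length w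
        E : Fin l → Carrier
        E k = expand (λ b → S b k) subsetSum w
        double-sum : ∀ {n p} (s : Fin n → Carrier) (b : Fin n → Fin p → Carrier) (t : Fin p → Carrier) →
          q * sum (λ j → s j * sum λ k → b j k * (q * (e * t k))) ≈
          e * sum (λ k → (sum λ j → s j * b j k) * t k)
        double-sum s b t = begin
          q * sum (λ j → s j * sum λ k → b j k * (q * (e * t k)))
            ≈⟨ *-congˡ (sum-cong-≋ λ j → trans (*-distribˡ-sum (s j) (λ k → b j k * (q * (e * t k)))) (sum-cong-≋ λ k →
                 solve 5 (λ s b q e t → s :* (b :* (q :* (e :* t))) := (q :* e) :* ((s :* b) :* t))
                   refl (s j) (b j k) q e (t k))) ⟩
          q * sum (λ j → sum λ k → (q * e) * ((s j * b j k) * t k))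
            ≈⟨ *-congˡ (trans (∑-comm (λ j k → (q * e) * ((s j * b j k) * t k)))
                 (sum-cong-≋ λ k → sym (trans
                   (*-congˡ (*-distribʳ-sum (t k) (λ j → s j * b j k)))
                   (*-distribˡ-sum (q * e) (λ j → (s j * b j k) * t k))))) ⟩
          q * sum (λ k → (q * e) * ((sum λ j → s j * b j k) * t k))
            ≈⟨ *-congˡ (*-distribˡ-sum (q * e) (λ k → (sum λ j → s j * b j k) * t k)) ⟨
          q * ((q * e) * Z)
            ≈⟨ solve 3 (λ q e z → q :* ((q :* e) :* z) := (q :* q) :* (e :* z)) refl q e Z ⟩
          (q * q) * (e * Z)
            ≈⟨ trans (*-congʳ (e^n*e^n≈1 (length w))) (*-identityˡ _) ⟩
          e * Z ∎
          where Z = sum λ k → (sum λ j → s j * b j k) * t k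

      -- With no rows of `A`, a nonempty `K` sees only the zero corner, so just the empty subset
      -- contributes.
      subsetSum-[] : subsetSum [] ≈ 1#
      subsetSum-[] = pair-δʳ id (pf B) refl λ x K →
        trans (pfBordered-∷ (inj₂ x) [] K)
          (trans (+-identityˡ _) (trans (*-identityˡ _) (expand-0ˡ _ K)))

      subsetSum≈pf : ∀ w → subsetSum w ≈ pf congruent w
      subsetSum≈pf = pf-unique congruent subsetSum-[] subsetSum-∷

-- Laplace expansion of the Pfaffian defined by permutations.

module Laplace {c ℓ} (R : CommutativeRing c ℓ) where

  open CommutativeRing R hiding (zero)
  open Matrices R
  open Words R
  open import Algebra.Properties.Semiring.Exp semiring using (_^_; ^-homo-*)
  open import Algebra.Properties.Semiring.Sum semiring
    using (sum; sum-cong-≋; sum-replicate-zero; *-distribˡ-sum)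
  open import Algebra.Properties.CommutativeMonoid.Sum *-commutativeMonoid
    using () renaming (sum to product; sum-cong-≋ to product-cong)
  open import Algebra.Solver.Ring.NaturalCoefficients.Default commutativeSemiring
    using (solve; _:*_; _:=_)
  open import Relation.Binary.Reasoning.Setoid setoid

  sumOver-cong : ∀ {a} {A : Set a} (xs : List A) {f g} → (∀ x → f x ≈ g x) → sumOver xs f ≈ sumOver xs g
  sumOver-cong []       p = refl
  sumOver-cong (x ∷ xs) p = +-cong (p x) (sumOver-cong xs p)

  sumOver-++ : ∀ {a} {A : Set a} (xs ys : List A) f → sumOver (xs ++ ys) f ≈ sumOver xs f + sumOver ys f
  sumOver-++ []       ys f = sym (+-identityˡ _)
  sumOver-++ (x ∷ xs) ys f = trans (+-congˡ (sumOver-++ xs ys f)) (sym (+-assoc _ _ _))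

  sumOver-map : ∀ {a b} {A : Set a} {B : Set b} (h : A → B) xs f →
    sumOver (map h xs) f ≡ sumOver xs (f ∘ h)
  sumOver-map h []       f = ≡.refl
  sumOver-map h (x ∷ xs) f = ≡.cong (f (h x) +_) (sumOver-map h xs f)

  sumOver-*ˡ : ∀ {a} {A : Set a} y (xs : List A) f → sumOver xs (λ x → y * f x) ≈ y * sumOver xs f
  sumOver-*ˡ y []       f = sym (zeroʳ y)
  sumOver-*ˡ y (x ∷ xs) f = trans (+-congˡ (sumOver-*ˡ y xs f)) (sym (distribˡ y _ _))

  sumOver-permutations : ∀ n f →
    sumOver (permutations (suc n)) f ≈ sum λ i → sumOver (permutations n) λ σ → f (insert zero i σ)
  sumOver-permutations n f = go id
    where
    -- The tail of `allFin` is tabulated by `suc`, so the induction needs a general `h`.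
    go : ∀ {k} (h : Fin k → Fin (suc n)) →
      sumOver (concatMap (λ i → map (insert zero i) (permutations n)) (tabulate h)) f ≈
      sum λ i → sumOver (permutations n) λ σ → f (insert zero (h i) σ)
    go {zero}  h = refl
    go {suc k} h = trans (sumOver-++ (map (insert zero (h zero)) (permutations n)) _ f)
      (+-cong (reflexive (sumOver-map (insert zero (h zero)) (permutations n) f)) (go (h ∘ suc)))

  -- Replaces filtering by zero terms, so that sums over F can be reindexed as sums over all
  -- permutations.
  when : ∀ {p} {P : Set p} → Dec P → Carrier → Carrier
  when d x = if does d then x else 0#

  when-cong : ∀ {p q} {P : Set p} {Q : Set q} (P? : Dec P) (Q? : Dec Q) {x y} →
    (P → Q) → (Q → P) → x ≈ y → when P? x ≈ when Q? y
  when-cong (yes _) (yes _) f g x≈y = x≈y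
  when-cong (yes p) (no ¬q) f g x≈y = contradiction (f p) ¬q
  when-cong (no ¬p) (yes q) f g x≈y = contradiction (g q) ¬p
  when-cong (no _)  (no _)  f g x≈y = refl

  when-no : ∀ {p} {P : Set p} (P? : Dec P) {x} → ¬ P → when P? x ≈ 0#
  when-no (yes p) ¬p = contradiction p ¬p
  when-no (no _)  ¬p = refl

  when-*ˡ : ∀ {p} {P : Set p} (P? : Dec P) x y → when P? (x * y) ≈ x * when P? y
  when-*ˡ (yes _) x y = refl
  when-*ˡ (no _)  x y = sym (zeroʳ x)

  sumOver-filter : ∀ {a p} {A : Set a} {P : A → Set p} (P? : Decidable P) xs f →
    sumOver (filter P? xs) f ≈ sumOver xs λ x → when (P? x) (f x)
  sumOver-filter P? []       f = refl
  sumOver-filter P? (x ∷ xs) f with does (P? x)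
  ... | true  = +-congˡ (sumOver-filter P? xs f)
  ... | false = trans (sumOver-filter P? xs f) (sym (+-identityˡ _))

  PfTerm : ∀ r → Matrix (r *ℕ 2) (r *ℕ 2) → Permutation′ (r *ℕ 2) → Carrier
  PfTerm r X σ = sgn σ * product (λ i → X (σ ⟨$⟩ʳ fst {r} i) (σ ⟨$⟩ʳ snd {r} i))

  PfSum : ∀ r → Matrix (r *ℕ 2) (r *ℕ 2) → Carrier
  PfSum r X = sumOver (filter (inF? r) (permutations (r *ℕ 2))) (PfTerm r X)

  sgn-insert : ∀ {n} i (σ : Permutation′ n) → sgn (insert zero i σ) ≈ e ^ toℕ i * sgn σ
  sgn-insert i σ = trans (reflexive (≡.cong (e ^_) (inversions-insert i σ))) (^-homo-* e (toℕ i) (inversions σ))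

  minor : ∀ {n} → Fin (suc n) → Matrix (suc (suc n)) (suc (suc n)) → Matrix n n
  minor j X a b = X (suc (punchIn j a)) (suc (punchIn j b))

  PfTerm-insert : ∀ r X j σ → PfTerm (suc r) X (insert zero zero (insert zero j σ)) ≈
    (e ^ toℕ j * X zero (suc j)) * PfTerm r (minor j X) σ
  PfTerm-insert r X j σ = begin
    sgn (insert zero zero (insert zero j σ)) * (X zero (suc j) * p)
      ≈⟨ *-congʳ (trans (sgn-insert zero (insert zero j σ)) (trans (*-identityˡ _) (sgn-insert j σ))) ⟩
    (e ^ toℕ j * sgn σ) * (X zero (suc j) * p)
      ≈⟨ solve 4 (λ d s x p → (d :* s) :* (x :* p) := (d :* x) :* (s :* p)) refl (e ^ toℕ j) (sgn σ) _ p ⟩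
    (e ^ toℕ j * X zero (suc j)) * (sgn σ * p) ∎
    where p = product λ i → minor j X (σ ⟨$⟩ʳ fst {r} i) (σ ⟨$⟩ʳ snd {r} i)

  -- A permutation in F starts with the pair zero, `suc j`. Inserting the value zero creates no
  -- inversion and inserting `j` creates `toℕ j`, which gives the sign.
  PfSum-laplace : ∀ r X → PfSum (suc r) X ≈
    sum λ j → (e ^ toℕ j * X zero (suc j)) * PfSum r (minor j X)
  PfSum-laplace r X = begin
    PfSum (suc r) X
      ≈⟨ sumOver-filter (inF? (suc r)) (permutations (suc r *ℕ 2)) (PfTerm (suc r) X) ⟩
    sumOver (permutations (suc r *ℕ 2)) term
      ≈⟨ sumOver-permutations (suc (r *ℕ 2)) term ⟩
    sumOver (permutations (suc (r *ℕ 2))) (λ σ → term (insert zero zero σ))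
      + sum (λ i → sumOver (permutations (suc (r *ℕ 2))) λ σ → term (insert zero (suc i) σ))
      ≈⟨ +-cong (sumOver-permutations (r *ℕ 2) (λ σ → term (insert zero zero σ)))
           (trans (sum-cong-≋ λ i → others-vanish i (permutations (suc (r *ℕ 2)))) (sum-replicate-zero (suc (r *ℕ 2)))) ⟩
    sum (λ j → sumOver (permutations (r *ℕ 2)) λ σ → term (insert zero zero (insert zero j σ))) + 0#
      ≈⟨ +-identityʳ _ ⟩
    sum (λ j → sumOver (permutations (r *ℕ 2)) λ σ → term (insert zero zero (insert zero j σ)))
      ≈⟨ sum-cong-≋ (λ j → trans (sumOver-cong (permutations (r *ℕ 2)) (term-insert j))
           (trans (sumOver-*ˡ (e ^ toℕ j * X zero (suc j)) (permutations (r *ℕ 2)) _) (*-congˡ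
             (sym (sumOver-filter (inF? r) (permutations (r *ℕ 2)) (PfTerm r (minor j X))))))) ⟩
    sum (λ j → (e ^ toℕ j * X zero (suc j)) * PfSum r (minor j X)) ∎
    where
    term : Permutation′ (suc r *ℕ 2) → Carrier
    term σ = when (inF? (suc r) σ) (PfTerm (suc r) X σ)
    others-vanish : ∀ i σs → sumOver σs (λ σ → term (insert zero (suc i) σ)) ≈ 0#
    others-vanish i []       = refl
    others-vanish i (σ ∷ σs) = trans (+-cong (when-no (inF? (suc r) (insert zero (suc i) σ))
      (λ inF → contradiction (InF-insert⇒≡0 r (suc i) σ inF) λ ())) (others-vanish i σs)) (+-identityˡ 0#)
    term-insert : ∀ j σ → term (insert zero zero (insert zero j σ)) ≈
      (e ^ toℕ j * X zero (suc j)) * when (inF? r σ) (PfTerm r (minor j X) σ)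
    term-insert j σ = trans
      (when-cong (inF? (suc r) (insert zero zero (insert zero j σ))) (inF? r σ)
        (InF-insert⁻ r j σ) (InF-insert⁺ r j σ) (PfTerm-insert r X j σ))
      (when-*ˡ (inF? r σ) _ _)

  -- Deleting letter `j` of a tabulated word amounts to composing with `punchIn j`.
  expand-tabulate : ∀ {I : Set} (g : I → Carrier) P {n} (f : Fin (suc n) → I) →
    expand g P (tabulate f) ≈ sum λ j → (e ^ toℕ j * g (f j)) * P (tabulate (f ∘ punchIn j))
  expand-tabulate g P {zero}  f = +-cong (*-congʳ (sym (*-identityˡ _))) (zeroʳ e)
  expand-tabulate g P {suc n} f = +-cong (*-congʳ (sym (*-identityˡ _)))
    (trans (*-congˡ (expand-tabulate g (λ u → P (f zero ∷ u)) (f ∘ suc)))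
    (trans (*-distribˡ-sum e (λ j → (e ^ toℕ j * g (f (suc j))) * P (f zero ∷ tabulate (f ∘ suc ∘ punchIn j))))
    (sum-cong-≋ λ j →
      solve 4 (λ e d x p → e :* ((d :* x) :* p) := ((e :* d) :* x) :* p) refl e (e ^ toℕ j) (g (f (suc j)))
        (P (f zero ∷ tabulate (f ∘ suc ∘ punchIn j))))))

  -- Both sides obey the same first-row expansion. Stating it for a form pulled back along `f` keeps
  -- minors in the same shape, with `f ∘ suc ∘ punchIn j` as the new index map.
  PfSum≈pf : ∀ {I : Set} (X : I → I → Carrier) r (f : Fin (r *ℕ 2) → I) →
    PfSum r (λ a b → X (f a) (f b)) ≈ pf X (tabulate f)
  PfSum≈pf X zero    f = trans (+-identityʳ _) (*-identityˡ 1#)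
  PfSum≈pf X (suc r) f = begin
    PfSum (suc r) (λ a b → X (f a) (f b))
      ≈⟨ PfSum-laplace r (λ a b → X (f a) (f b)) ⟩
    sum (λ j → (e ^ toℕ j * X (f zero) (f (suc j)))
               * PfSum r (λ a b → X (f (suc (punchIn j a))) (f (suc (punchIn j b)))))
      ≈⟨ sum-cong-≋ (λ j → *-congˡ {e ^ toℕ j * X (f zero) (f (suc j))} (PfSum≈pf X r (f ∘ suc ∘ punchIn j))) ⟩
    sum (λ j → (e ^ toℕ j * X (f zero) (f (suc j))) * pf X (tabulate (f ∘ suc ∘ punchIn j)))
      ≈⟨ expand-tabulate (X (f zero)) (pf X) (f ∘ suc) ⟨
    expand (X (f zero)) (pf X) (tabulate (f ∘ suc))
      ≈⟨ pf-∷ X (f zero) (tabulate (f ∘ suc)) ⟨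
    pf X (tabulate f) ∎

  Pf≈pf : ∀ {n} (2∣n : 2 ∣ n) {I : Set} (X : I → I → Carrier) (f : Fin n → I) →
    Pf 2∣n (λ a b → X (f a) (f b)) ≈ pf X (tabulate f)
  Pf≈pf (divides r ≡.refl) X f = PfSum≈pf X r f

  Pf-cong : ∀ {n} (2∣n : 2 ∣ n) {X Y : Matrix n n} → (∀ a b → X a b ≈ Y a b) → Pf 2∣n X ≈ Pf 2∣n Y
  Pf-cong (divides r ≡.refl) X≈Y = sumOver-cong (filter (inF? r) (permutations (r *ℕ 2)))
    λ σ → *-congˡ (product-cong λ i → X≈Y (σ ⟨$⟩ʳ fst {r} i) (σ ⟨$⟩ʳ snd {r} i))

  -- Each expansion removes two letters, so an odd word never reaches the empty word, the only
  -- source of a nonzero value.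
  pf-odd : ∀ {I : Set} (X : I → I → Carrier) w → ¬ (2 ∣ length w) → pf X w ≈ 0#
  pf-odd {I} X w = pfUpTo-odd (suc (length w)) w
    where
    pfUpTo-odd : ∀ n w → ¬ (2 ∣ length w) → pfUpTo X n w ≈ 0#
    pfUpTo-odd zero    w       odd = refl
    pfUpTo-odd (suc n) []      odd = contradiction (2 ∣0) odd
    pfUpTo-odd (suc n) (x ∷ w) odd = trans
      (expand-cong {Q = λ _ → 0#} (λ _ → refl) w λ u eq → pfUpTo-odd n u λ 2∣u →
        odd (≡.subst (λ k → 2 ∣ suc k) eq (∣m∣n⇒∣m+n ∣-refl 2∣u)))
      (expand-0ʳ (X x) w)

  -- Sums over subsets as pairings.

  -- `subsets` and `pair` both branch on whether the first letter is taken, and `element` lists that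
  -- letter first.
  sumOver-subsets : ∀ {I : Set} n (h : Fin n → I) f g →
    sumOver (subsets n) (λ K → f (tabulate (h ∘ element K)) * g (tabulate (h ∘ element K))) ≈ pair n h f g
  sumOver-subsets zero    h f g = +-identityʳ _
  sumOver-subsets (suc n) h f g = begin
    sumOver (map (outside ∷_) (subsets n) ++ map (inside ∷_) (subsets n)) F
      ≈⟨ sumOver-++ (map (outside ∷_) (subsets n)) _ F ⟩
    sumOver (map (outside ∷_) (subsets n)) F + sumOver (map (inside ∷_) (subsets n)) F
      ≡⟨ ≡.cong₂ _+_ (sumOver-map (outside ∷_) (subsets n) F) (sumOver-map (inside ∷_) (subsets n) F) ⟩
    sumOver (subsets n) (λ K → F (outside ∷ K)) + sumOver (subsets n) (λ K → F (inside ∷ K))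
      ≈⟨ +-cong (sumOver-subsets n (h ∘ suc) f g) (sumOver-subsets n (h ∘ suc) _ _) ⟩
    pair (suc n) h f g ∎
    where
    F : Subset (suc n) → Carrier
    F K = f (tabulate (h ∘ element K)) * g (tabulate (h ∘ element K))

  -- `F` may depend on the evenness proof, so `even` covers all such proofs, in particular the one
  -- found by the decision procedure.
  sumOver-evenSubsets : ∀ n (F : EvenSubset n → Carrier) (G : Subset n → Carrier) →
    (∀ K 2∣∣K∣ → F (K , 2∣∣K∣) ≈ G K) → (∀ K → ¬ (2 ∣ ∣ K ∣) → G K ≈ 0#) →
    sumOver (evenSubsets n) F ≈ sumOver (subsets n) G
  sumOver-evenSubsets n F G even odd = go (subsets n)
    where
    go : ∀ Ks → sumOver (mapMaybe (λ K → Maybe.map (K ,_) (dec⇒maybe (2 ∣? ∣ K ∣))) Ks) F ≈ sumOver Ks G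
    go []       = refl
    go (K ∷ Ks) with 2 ∣? ∣ K ∣
    ... | yes 2∣∣K∣ = +-cong (even K 2∣∣K∣) (go Ks)
    ... | no  2∤∣K∣ = trans (go Ks) (sym (trans (+-congʳ (odd K 2∤∣K∣)) (+-identityˡ _)))

  SkewSymmetric⇒Skew : ∀ {n} {X : Matrix n n} → SkewSymmetric X → Skew X
  SkewSymmetric⇒Skew {X = X} (skew , diag) =
    (λ i j → trans (+-congˡ (skew i j)) (-‿inverseʳ (X i j))) , diag

-- Translation of the matrix identity into words.

tabulate-splitAt : ∀ {A : Set} m {n} (f : Fin m → A) (g : Fin n → A) →
  tabulate ([ f , g ]′ ∘ splitAt m) ≡ tabulate f ++ tabulate g
tabulate-splitAt zero    f g = ≡.refl
tabulate-splitAt (suc m) f g = ≡.cong (f zero ∷_) (≡.trans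
  (tabulate-cong λ i → [,]-map (splitAt m i))
  (tabulate-splitAt m (f ∘ suc) g))

module _ {c ℓ} (R : CommutativeRing c ℓ) where

  open CommutativeRing R hiding (zero)
  open Matrices R
  open Words R
  open Laplace R
  open import Relation.Binary.Reasoning.Setoid setoid

  module _ {m l : ℕ} (A : Matrix m m) (B : Matrix l l) (S : Matrix m l) where

    -- The block matrix is `bordered` pulled back along `index`, and tabulating `index` lists the
    -- rows of `A` followed by the elements of `K`.
    Pf-block : ∀ K (d : 2 ∣ (m +ℕ ∣ K ∣)) →
      Pf d (block A (columns S K) (-ᴹ (columns S K ᵀ)) O) ≈
      pfBordered A B S (allFin m) (tabulate (element K))
    Pf-block K d = begin
      Pf d (block A (columns S K) (-ᴹ (columns S K ᵀ)) O)
        ≈⟨ Pf-cong d entries ⟩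
      Pf d (λ a b → bordered A B S (index a) (index b))
        ≈⟨ Pf≈pf d (bordered A B S) index ⟩
      pf (bordered A B S) (tabulate index)
        ≡⟨ ≡.cong (pf (bordered A B S)) (≡.trans (tabulate-splitAt m inj₁ (inj₂ ∘ element K))
             (≡.cong₂ _++_ (≡.sym (map-tabulate id inj₁)) (≡.sym (map-tabulate (element K) inj₂)))) ⟩
      pfBordered A B S (allFin m) (tabulate (element K)) ∎
      where
      index : Fin (m +ℕ ∣ K ∣) → Fin m ⊎ Fin l
      index a = [ inj₁ , inj₂ ∘ element K ]′ (splitAt m a)
      entries : ∀ a b → block A (columns S K) (-ᴹ (columns S K ᵀ)) O a b ≈ bordered A B S (index a) (index b)
      entries a b with splitAt m a
      ... | inj₁ _ with splitAt m b
      ...   | inj₁ _ = refl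
      ...   | inj₂ _ = refl
      entries a b | inj₂ _ with splitAt m b
      ...   | inj₁ _ = refl
      ...   | inj₂ _ = refl

    -- Odd subsets may be added to the sum, since `pf B` vanishes on words of odd length.
    sumOver-evenSubsets≈subsetSum : ∀ (2∣m : 2 ∣ m) →
      sumOver (evenSubsets l) (λ (K , 2∣∣K∣) →
        Pf 2∣∣K∣ (principal B K)
        * Pf (∣m∣n⇒∣m+n 2∣m 2∣∣K∣) (block A (columns S K) (-ᴹ (columns S K ᵀ)) O))
      ≈ subsetSum A B S (allFin m)
    sumOver-evenSubsets≈subsetSum 2∣m = trans
      (sumOver-evenSubsets l _
        (λ K → pf B (tabulate (element K)) * pfBordered A B S (allFin m) (tabulate (element K)))
        (λ K 2∣∣K∣ → *-cong (Pf≈pf 2∣∣K∣ B (element K)) (Pf-block K (∣m∣n⇒∣m+n 2∣m 2∣∣K∣)))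
        (λ K 2∤∣K∣ → trans (*-congʳ (pf-odd B (tabulate (element K))
          (2∤∣K∣ ∘ ≡.subst (2 ∣_) (length-tabulate (element K))))) (zeroˡ _)))
      (sumOver-subsets l id (pf B) (pfBordered A B S (allFin m)))

theorem3p4 : ∀ {c ℓ} (R : CommutativeRing c ℓ) →
    let open CommutativeRing R
        open Matrices R
    in
    ∀ (m l : ℕ) (2∣m : 2 ∣ m) .{{_ : NonZero l}}
      (A : Matrix m m) (B : Matrix l l) (S : Matrix m l) →
    SkewSymmetric A → SkewSymmetric B →
    sumOver (evenSubsets l) (λ (K , 2∣∣K∣) →
      Pf 2∣∣K∣ (principal B K)
      * Pf (∣m∣n⇒∣m+n 2∣m 2∣∣K∣)
           (block A (columns S K) (-ᴹ (columns S K ᵀ)) O))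
    ≈ Pf 2∣m (A -ᴹ S *ᴹ B *ᴹ S ᵀ)
theorem3p4 R m l 2∣m A B S skewA skewB = begin
  sumOver (evenSubsets l) _
    ≈⟨ sumOver-evenSubsets≈subsetSum R A B S 2∣m ⟩
  subsetSum A B S (allFin m)
    ≈⟨ subsetSum≈pf A B S (SkewSymmetric⇒Skew skewA) (SkewSymmetric⇒Skew skewB) (allFin m) ⟩
  -- This form and `congruent A B S` agree by computation.
  pf (A -ᴹ S *ᴹ B *ᴹ S ᵀ) (allFin m)
    ≈⟨ Pf≈pf 2∣m (A -ᴹ S *ᴹ B *ᴹ S ᵀ) id ⟨
  Pf 2∣m (A -ᴹ S *ᴹ B *ᴹ S ᵀ)      ∎
  where
  open CommutativeRing R
  open Matrices R
  open Words R
  open Laplace R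
  open import Relation.Binary.Reasoning.Setoid setoid
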